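{- Let $m,n$ be distinct square-free rational integers such that $K=\mathbb{Q}(\sqrt{m},\sqrt{n})$ is a quartic number field, let $\mathcal{A}=\mathbb{Z}[\sqrt{m},\sqrt{n}]$, and let $\sigma,\tau$ be any two different non-zero ring endomorphisms of $\mathcal{A}$. Then $\mathcal{A}$ has non-trivial outer $(\sigma,\tau)$-derivations, that is, $\mathrm{Out}_{(\sigma,\tau)}(\mathcal{A})\neq\{0\}$.
   Context: A $(\sigma,\tau)$-derivation of $\mathcal{A}$ is a $\mathbb{Z}$-linear map $D:\mathcal{A}\to\mathcal{A}$ with $D(xy)=D(x)\tau(y)+\sigma(x)D(y)$ for all $x,y\in\mathcal{A}$. It is called inner if there exists $\beta\in\mathcal{A}$ with $D(x)=\beta\tau(x)-\sigma(x)\beta$ for all $x\in\mathcal{A}$. $\mathrm{Out}_{(\sigma,\tau)}(\mathcal{A})$ denotes the quotient of the $\mathbb{Z}$-module of all $(\sigma,\tau)$-derivations of $\mathcal{A}$ by the submodule of inner ones. -}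

module Defs where

open import Level using (Level; _⊔_; suc)
open import Algebra.Apartness.Bundles using (HeytingField)
open import Algebra.Bundles
  using (RawRing; RawGroup; AbelianGroup; Ring; CommutativeRing)
import Algebra.Construct.Pointwise as Pointwise
open import Algebra.Definitions.RawMonoid using (sum)
open import Algebra.Morphism.Structures
  using ( IsGroupHomomorphism; IsGroupMonomorphism; IsRingWithoutOneHomomorphism
        ; IsRingHomomorphism; IsRingMonomorphism)
import Algebra.Morphism.GroupMonomorphism as GroupMonomorphism
import Algebra.Morphism.RingMonomorphism as RingMonomorphism
import Algebra.Properties.AbelianGroup as AbelianGroupProperties
import Algebra.Properties.Ring as RingProperties
open import Data.Fin.Base using (Fin)
open import Data.Integer.Base using (ℤ; 1ℤ) renaming (_*_ to _*ℤ_)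
open import Data.Integer.Divisibility using (_∣_)
open import Data.Nat.Base using (ℕ)
open import Data.Product.Base using (Σ; ∃-syntax; _,_; proj₁)
open import Data.Rational.Base using (ℚ; 0ℚ) renaming (_/_ to _/ℚ_; +-*-rawRing to ℚ-rawRing)
open import Data.Sum.Base using (_⊎_)
open import Relation.Binary.PropositionalEquality.Core using (_≡_)
import Relation.Binary.Reasoning.Setoid as SetoidReasoning
open import Relation.Nullary.Negation using (¬_)
open import Relation.Unary using (Pred; _∈_)

private
  variable
    c ℓ ℓ₁ ℓ₂ p : Level

Squarefree : ℤ → Set
Squarefree m = ∀ d → d *ℤ d ∣ m → d ∣ 1ℤ

record FieldOverℚ c ℓ₁ ℓ₂ : Set (suc (c ⊔ ℓ₁ ⊔ ℓ₂)) where
  field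
    heytingField : HeytingField c ℓ₁ ℓ₂

  open HeytingField heytingField public

  commutativeRing : CommutativeRing c ℓ₁
  commutativeRing = record { isCommutativeRing = isCommutativeRing }

  open CommutativeRing commutativeRing public
    using (rawRing; +-rawMonoid)

  field
    ι      : ℚ → Carrier
    ι-homo : IsRingHomomorphism ℚ-rawRing rawRing ι

  ιℤ : ℤ → Carrier
  ιℤ k = ι (k /ℚ 1)

module _ (K : FieldOverℚ c ℓ₁ ℓ₂) where
  open FieldOverℚ K

  linearCombination : ∀ {d} → (Fin d → ℚ) → (Fin d → Carrier) → Carrier
  linearCombination q e = sum +-rawMonoid (λ i → ι (q i) * e i)

  record IsℚBasis {d} (e : Fin d → Carrier) : Set (c ⊔ ℓ₁) where
    field
      spanning    : ∀ x → ∃[ q ] linearCombination q e ≈ x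
      independent : ∀ q → linearCombination q e ≈ 0# → ∀ i → q i ≡ 0ℚ

  -- [K : ℚ] = d
  HasDegree : ℕ → Set (c ⊔ ℓ₁)
  HasDegree d = Σ (Fin d → Carrier) IsℚBasis

  -- ℚ(S), the smallest subfield containing S.
  data ℚ⟨_⟩ (S : Pred Carrier p) : Pred Carrier (c ⊔ ℓ₁ ⊔ p) where
    generator : ∀ {x} → x ∈ S → x ∈ ℚ⟨ S ⟩
    rational  : ∀ q → ι q ∈ ℚ⟨ S ⟩
    sum-∈     : ∀ {x y} → x ∈ ℚ⟨ S ⟩ → y ∈ ℚ⟨ S ⟩ → x + y ∈ ℚ⟨ S ⟩
    neg-∈     : ∀ {x} → x ∈ ℚ⟨ S ⟩ → - x ∈ ℚ⟨ S ⟩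
    product-∈ : ∀ {x y} → x ∈ ℚ⟨ S ⟩ → y ∈ ℚ⟨ S ⟩ → x * y ∈ ℚ⟨ S ⟩
    inverse-∈ : ∀ {x y} → x ∈ ℚ⟨ S ⟩ → x * y ≈ 1# → y ∈ ℚ⟨ S ⟩
    resp-∈    : ∀ {x y} → x ≈ y → x ∈ ℚ⟨ S ⟩ → y ∈ ℚ⟨ S ⟩

module _ (R : CommutativeRing c ℓ) where
  open CommutativeRing R

  -- ℤ[S], the smallest unital subring containing S.
  data ℤ⟨_⟩ (S : Pred Carrier p) : Pred Carrier (c ⊔ ℓ ⊔ p) where
    generator : ∀ {x} → x ∈ S → x ∈ ℤ⟨ S ⟩
    zero-∈    : 0# ∈ ℤ⟨ S ⟩
    one-∈     : 1# ∈ ℤ⟨ S ⟩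
    sum-∈     : ∀ {x y} → x ∈ ℤ⟨ S ⟩ → y ∈ ℤ⟨ S ⟩ → x + y ∈ ℤ⟨ S ⟩
    neg-∈     : ∀ {x} → x ∈ ℤ⟨ S ⟩ → - x ∈ ℤ⟨ S ⟩
    product-∈ : ∀ {x y} → x ∈ ℤ⟨ S ⟩ → y ∈ ℤ⟨ S ⟩ → x * y ∈ ℤ⟨ S ⟩
    resp-∈    : ∀ {x y} → x ≈ y → x ∈ ℤ⟨ S ⟩ → y ∈ ℤ⟨ S ⟩

  generatedSubring : Pred Carrier p → CommutativeRing (c ⊔ ℓ ⊔ p) ℓ
  generatedSubring S = record
    { isCommutativeRing =
        RingMonomorphism.isCommutativeRing inclusion isCommutativeRing }
    where
    raw : RawRing _ _
    raw = record
      { Carrier = Σ Carrier ℤ⟨ S ⟩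
      ; _≈_     = λ x y → proj₁ x ≈ proj₁ y
      ; _+_     = λ (x , x∈) (y , y∈) → x + y , sum-∈ x∈ y∈
      ; _*_     = λ (x , x∈) (y , y∈) → x * y , product-∈ x∈ y∈
      ; -_      = λ (x , x∈) → - x , neg-∈ x∈
      ; 0#      = 0# , zero-∈
      ; 1#      = 1# , one-∈
      }

    inclusion : IsRingMonomorphism raw rawRing proj₁
    inclusion = record
      { isRingHomomorphism = record
        { isSemiringHomomorphism = record
          { isNearSemiringHomomorphism = record
            { +-isMonoidHomomorphism = record
              { isMagmaHomomorphism = record
                { isRelHomomorphism = record { cong = λ eq → eq }
                ; homo = λ _ _ → refl }
              ; ε-homo = refl }
            ; *-homo = λ _ _ → refl }
          ; 1#-homo = refl }
        ; -‿homo = λ _ → refl }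
      ; injective = λ eq → eq
      }

module _ (K : FieldOverℚ c ℓ₁ ℓ₂) where
  open FieldOverℚ K

  ❴_,_❵ : Carrier → Carrier → Pred Carrier ℓ₁
  ❴ a , b ❵ x = x ≈ a ⊎ x ≈ b

  -- K = ℚ(a,b)
  IsGeneratedBy : Carrier → Carrier → Set (c ⊔ ℓ₁)
  IsGeneratedBy a b = ∀ x → x ∈ ℚ⟨_⟩ K ❴ a , b ❵

  ℤ[_,_] : Carrier → Carrier → Ring (c ⊔ ℓ₁) ℓ₁
  ℤ[ a , b ] = CommutativeRing.ring (generatedSubring commutativeRing ❴ a , b ❵)

record Subgroup (G : AbelianGroup c ℓ) p : Set (c ⊔ ℓ ⊔ suc p) where
  open AbelianGroup G
  field
    member    : Pred Carrier p
    ε-member  : ε ∈ member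
    ∙-member  : ∀ {x y} → x ∈ member → y ∈ member → x ∙ y ∈ member
    ⁻¹-member : ∀ {x} → x ∈ member → x ⁻¹ ∈ member
    resp      : ∀ {x y} → x ≈ y → x ∈ member → y ∈ member

-- G / N has the elements of G, identified when they differ by an element of N.
_/_ : (G : AbelianGroup c ℓ) → Subgroup G p → AbelianGroup c p
G / N = record
  { Carrier = Carrier
  ; _≈_     = _~_
  ; _∙_     = _∙_
  ; ε       = ε
  ; _⁻¹     = _⁻¹
  ; isAbelianGroup = record
    { isGroup = record
      { isMonoid = record
        { isSemigroup = record
          { isMagma = record
            { isEquivalence = record
              { refl  = ≈⇒~ refl
              ; sym   = λ {x} {y} x~y →
                  resp (⁻¹-anti-homo‿- x y) (⁻¹-member x~y)
              ; trans = λ {x} {y} {z} x~y y~z →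
                  resp (telescope x y z) (∙-member x~y y~z)
              }
            ; ∙-cong = λ {x} {y} {u} {v} x~y u~v →
                resp (interchange x y u v) (∙-member x~y u~v)
            }
          ; assoc = λ x y z → ≈⇒~ (assoc x y z)
          }
        ; identity = (λ x → ≈⇒~ (identityˡ x)) , (λ x → ≈⇒~ (identityʳ x))
        }
      ; inverse = (λ x → ≈⇒~ (inverseˡ x)) , (λ x → ≈⇒~ (inverseʳ x))
      ; ⁻¹-cong = λ {x} {y} x~y →
          resp (sym (⁻¹-∙-comm x (y ⁻¹))) (⁻¹-member x~y)
      }
    ; comm = λ x y → ≈⇒~ (comm x y)
    }
  }
  where
  open AbelianGroup G
  open AbelianGroupProperties G
  open Subgroup N
  open SetoidReasoning setoid

  _~_ : Carrier → Carrier → Set _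
  x ~ y = x - y ∈ member

  ≈⇒~ : ∀ {x y} → x ≈ y → x ~ y
  ≈⇒~ x≈y = resp (sym (x≈y⇒x∙y⁻¹≈ε x≈y)) ε-member

  telescope : ∀ x y z → (x - y) ∙ (y - z) ≈ x - z
  telescope x y z = begin
    (x - y) ∙ (y - z)      ≈⟨ assoc (x - y) y (z ⁻¹) ⟨
    ((x - y) ∙ y) ∙ z ⁻¹   ≈⟨ ∙-congʳ (//-rightDividesˡ y x) ⟩
    x - z                  ∎

  interchange : ∀ x y u v → (x - y) ∙ (u - v) ≈ (x ∙ u) - (y ∙ v)
  interchange x y u v = begin
    (x ∙ y ⁻¹) ∙ (u ∙ v ⁻¹)   ≈⟨ assoc x (y ⁻¹) (u ∙ v ⁻¹) ⟩
    x ∙ (y ⁻¹ ∙ (u ∙ v ⁻¹))   ≈⟨ ∙-congˡ (assoc (y ⁻¹) u (v ⁻¹)) ⟨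
    x ∙ ((y ⁻¹ ∙ u) ∙ v ⁻¹)   ≈⟨ ∙-congˡ (∙-congʳ (comm (y ⁻¹) u)) ⟩
    x ∙ ((u ∙ y ⁻¹) ∙ v ⁻¹)   ≈⟨ ∙-congˡ (assoc u (y ⁻¹) (v ⁻¹)) ⟩
    x ∙ (u ∙ (y ⁻¹ ∙ v ⁻¹))   ≈⟨ assoc x u (y ⁻¹ ∙ v ⁻¹) ⟨
    (x ∙ u) ∙ (y ⁻¹ ∙ v ⁻¹)   ≈⟨ ∙-congˡ (⁻¹-∙-comm y v) ⟩
    (x ∙ u) - (y ∙ v)         ∎

Nontrivial : AbelianGroup c ℓ → Set (c ⊔ ℓ)
Nontrivial G = ∃[ x ] ¬ x ≈ ε
  where open AbelianGroup G

module _ (A : Ring c ℓ) where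
  open Ring A

  -- Not assumed to preserve 1#, so that the zero map is a ring endomorphism.
  IsRingEndomorphism : (Carrier → Carrier) → Set (c ⊔ ℓ)
  IsRingEndomorphism = IsRingWithoutOneHomomorphism
    (RawRing.rawRingWithoutOne rawRing) (RawRing.rawRingWithoutOne rawRing)

  _≗_ : (f g : Carrier → Carrier) → Set (c ⊔ ℓ)
  f ≗ g = ∀ x → f x ≈ g x

  IsZeroMap : (Carrier → Carrier) → Set (c ⊔ ℓ)
  IsZeroMap f = ∀ x → f x ≈ 0#

module TwistedDerivations
  (A : Ring c ℓ) (σ τ : Ring.Carrier A → Ring.Carrier A) where

  open Ring A
  open RingProperties A
  open SetoidReasoning setoid

  private
    interchange : ∀ x y u v → (x + y) + (u + v) ≈ (x + u) + (y + v)
    interchange x y u v = begin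
      (x + y) + (u + v)   ≈⟨ +-assoc x y (u + v) ⟩
      x + (y + (u + v))   ≈⟨ +-congˡ (+-assoc y u v) ⟨
      x + ((y + u) + v)   ≈⟨ +-congˡ (+-congʳ (+-comm y u)) ⟩
      x + ((u + y) + v)   ≈⟨ +-congˡ (+-assoc u y v) ⟩
      x + (u + (y + v))   ≈⟨ +-assoc x u (y + v) ⟨
      (x + u) + (y + v)   ∎

  record Derivation : Set (c ⊔ ℓ) where
    field
      D        : Carrier → Carrier
      -- Between abelian groups, the ℤ-linear maps are the additive ones.
      ℤ-linear : IsGroupHomomorphism +-rawGroup +-rawGroup D
      leibniz  : ∀ x y → D (x * y) ≈ D x * τ y + σ x * D y

    open IsGroupHomomorphism ℤ-linear public
      renaming (homo to D-+; ε-homo to D-0; ⁻¹-homo to D-neg; ⟦⟧-cong to D-cong)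

  open Derivation

  IsInner : Derivation → Set (c ⊔ ℓ)
  IsInner δ = ∃[ β ] (∀ x → D δ x ≈ β * τ x - σ x * β)

  private
    additive : (f : Carrier → Carrier) → (∀ {x y} → x ≈ y → f x ≈ f y) →
               (∀ x y → f (x + y) ≈ f x + f y) → f 0# ≈ 0# →
               (∀ x → f (- x) ≈ - f x) →
               IsGroupHomomorphism +-rawGroup +-rawGroup f
    additive f cong homo 0-homo neg-homo = record
      { isMonoidHomomorphism = record
        { isMagmaHomomorphism = record
          { isRelHomomorphism = record { cong = cong }
          ; homo = homo }
        ; ε-homo = 0-homo }
      ; ⁻¹-homo = neg-homo }

  zeroDerivation : Derivation
  zeroDerivation .D _ = 0#
  zeroDerivation .ℤ-linear =
    additive _ (λ _ → refl) (λ _ _ → sym (+-identityˡ 0#)) refl (λ _ → sym -0#≈0#)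
  zeroDerivation .leibniz x y = begin
    0#                     ≈⟨ +-identityˡ 0# ⟨
    0# + 0#                ≈⟨ +-cong (zeroˡ (τ y)) (zeroʳ (σ x)) ⟨
    0# * τ y + σ x * 0#    ∎

  _⊕_ : Derivation → Derivation → Derivation
  (δ ⊕ ε) .D x = D δ x + D ε x
  (δ ⊕ ε) .ℤ-linear = additive _
    (λ eq → +-cong (D-cong δ eq) (D-cong ε eq))
    (λ x y → trans (+-cong (D-+ δ x y) (D-+ ε x y)) (interchange _ _ _ _))
    (trans (+-cong (D-0 δ) (D-0 ε)) (+-identityˡ 0#))
    (λ x → trans (+-cong (D-neg δ x) (D-neg ε x)) (-‿+-comm _ _))
  (δ ⊕ ε) .leibniz x y = begin
    D δ (x * y) + D ε (x * y)
      ≈⟨ +-cong (leibniz δ x y) (leibniz ε x y) ⟩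
    (D δ x * τ y + σ x * D δ y) + (D ε x * τ y + σ x * D ε y)
      ≈⟨ interchange _ _ _ _ ⟩
    (D δ x * τ y + D ε x * τ y) + (σ x * D δ y + σ x * D ε y)
      ≈⟨ +-cong (distribʳ (τ y) _ _) (distribˡ (σ x) _ _) ⟨
    (D δ x + D ε x) * τ y + σ x * (D δ y + D ε y) ∎

  ⊖_ : Derivation → Derivation
  (⊖ δ) .D x = - D δ x
  (⊖ δ) .ℤ-linear = additive _
    (λ eq → -‿cong (D-cong δ eq))
    (λ x y → trans (-‿cong (D-+ δ x y)) (sym (-‿+-comm _ _)))
    (trans (-‿cong (D-0 δ)) -0#≈0#)
    (λ x → -‿cong (D-neg δ x))
  (⊖ δ) .leibniz x y = begin
    - D δ (x * y)                         ≈⟨ -‿cong (leibniz δ x y) ⟩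
    - (D δ x * τ y + σ x * D δ y)         ≈⟨ -‿+-comm _ _ ⟨
    - (D δ x * τ y) + - (σ x * D δ y)     ≈⟨ +-cong (-‿distribˡ-* _ _) (-‿distribʳ-* _ _) ⟩
    - D δ x * τ y + σ x * - D δ y         ∎

  -- A ℤ-module is the same thing as an abelian group; Der is the ℤ-module of
  -- all (σ,τ)-derivations, Inn the submodule of inner ones.
  Der : AbelianGroup (c ⊔ ℓ) (c ⊔ ℓ)
  Der = record
    { isAbelianGroup = GroupMonomorphism.isAbelianGroup pointwise
        (AbelianGroup.isAbelianGroup (Pointwise.abelianGroup Carrier +-abelianGroup)) }
    where
    raw : RawGroup (c ⊔ ℓ) (c ⊔ ℓ)
    raw = record
      { Carrier = Derivation
      ; _≈_     = λ δ ε → ∀ x → D δ x ≈ D ε x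
      ; _∙_     = _⊕_
      ; ε       = zeroDerivation
      ; _⁻¹     = ⊖_
      }

    pointwise : IsGroupMonomorphism raw
      (AbelianGroup.rawGroup (Pointwise.abelianGroup Carrier +-abelianGroup)) D
    pointwise = record
      { isGroupHomomorphism = record
        { isMonoidHomomorphism = record
          { isMagmaHomomorphism = record
            { isRelHomomorphism = record { cong = λ eq → eq }
            ; homo = λ _ _ _ → refl }
          ; ε-homo = λ _ → refl }
        ; ⁻¹-homo = λ _ _ → refl }
      ; injective = λ eq → eq
      }

  Inn : Subgroup Der (c ⊔ ℓ)
  Inn = record
    { member    = IsInner
    ; ε-member  = 0# , λ x → begin
        0#                     ≈⟨ -‿inverseʳ 0# ⟨
        0# - 0#                ≈⟨ +-cong (zeroˡ (τ x)) (-‿cong (zeroʳ (σ x))) ⟨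
        0# * τ x - σ x * 0#    ∎
    ; ∙-member  = λ {δ} {ε} (β , δ≈) (γ , ε≈) → β + γ , λ x → begin
        D δ x + D ε x
          ≈⟨ +-cong (δ≈ x) (ε≈ x) ⟩
        (β * τ x - σ x * β) + (γ * τ x - σ x * γ)
          ≈⟨ interchange _ _ _ _ ⟩
        (β * τ x + γ * τ x) + (- (σ x * β) + - (σ x * γ))
          ≈⟨ +-cong (sym (distribʳ _ _ _)) (-‿+-comm _ _) ⟩
        (β + γ) * τ x - (σ x * β + σ x * γ)
          ≈⟨ +-congˡ (-‿cong (distribˡ _ _ _)) ⟨
        (β + γ) * τ x - σ x * (β + γ) ∎
    ; ⁻¹-member = λ {δ} (β , δ≈) → - β , λ x → begin
        - D δ x                          ≈⟨ -‿cong (δ≈ x) ⟩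
        - (β * τ x - σ x * β)            ≈⟨ -‿+-comm _ _ ⟨
        - (β * τ x) + - (- (σ x * β))    ≈⟨ +-cong (-‿distribˡ-* _ _) (-‿cong (-‿distribʳ-* _ _)) ⟩
        - β * τ x - σ x * - β            ∎
    ; resp      = λ eq (β , δ≈) → β , λ x → trans (sym (eq x)) (δ≈ x)
    }

  Out : AbelianGroup (c ⊔ ℓ) (c ⊔ ℓ)
  Out = Der / Inn

open TwistedDerivations public using (Out)

{-# OPTIONS --safe #-}
-- With γ = 1/2, put D = γ (τ − σ). Both σ and τ send √m to ± √m and √n to ± √n,
-- so τ − σ takes values in 2A and D is a (σ,τ)-derivation of A. If D were inner, say
-- D = β (τ − σ) with β ∈ A, then β = 1/2 because σ ≠ τ. But 1/2 ∉ A: if h = 1/2 lies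
-- in B[a] = B + B a with a² ∈ B, then h² − 2uh + u² − a²v² = 0 for some u, v ∈ B, so
-- that h = 2 (u − u² + a²v²) ∈ B; hence 1/2 would descend to ℤ.
module Submission where

open import Defs
open import Algebra.Bundles using (CommutativeRing; Ring)
open import Data.Integer.Base using (ℤ)
open import Relation.Binary.PropositionalEquality using (_≢_)
open import Relation.Nullary.Negation using (¬_)

open import Level using (Level; _⊔_)
open import Algebra.Morphism.Structures using (module RingMorphisms; module RingWithoutOneMorphisms)
open import Algebra.Solver.Ring.AlmostCommutativeRing
  using (fromCommutativeRing; _-Raw-AlmostCommutative⟶_)
import Algebra.Apartness.Properties.HeytingCommutativeRing as HeytingCommutativeRingProperties
import Algebra.Properties.Ring as RingProperties
import Algebra.Solver.Ring as RingSolver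
open import Data.Integer.Base using (+_; +0; +[1+_]; -[1+_]; 0ℤ)
import Data.Integer.Base as ℤ
import Data.Integer.Properties as ℤ
open import Data.Maybe.Base using (Maybe; just; nothing)
open import Data.Nat.Base using (zero; suc)
import Data.Nat.Divisibility as ℕ
open import Data.Product.Base using (Σ; ∃-syntax; _×_; _,_; proj₁; proj₂)
open import Data.Rational.Base using (ℚ; 0ℚ; 1ℚ; ½; 1/_; toℚᵘ)
import Data.Rational.Base as ℚ
import Data.Rational.Properties as ℚ
open import Data.Rational.Unnormalised.Base using (mkℚᵘ; *≡*)
import Data.Rational.Unnormalised.Base as ℚᵘ
import Data.Rational.Unnormalised.Properties as ℚᵘ
open import Data.Sum.Base using (_⊎_; inj₁; inj₂)
open import Relation.Binary.PropositionalEquality as ≡ using (_≡_; refl)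
import Relation.Binary.Reasoning.Setoid as SetoidReasoning
open import Relation.Nullary.Decidable.Core using (yes; no)
open import Relation.Nullary.Negation using (contradiction)
open import Relation.Unary using (Pred; _∈_)

private
  variable
    c ℓ₁ ℓ₂ p : Level

-- Square-free integers, and ℤ inside ℚ.

-- 2 · 2 divides 0, but 2 does not divide 1. Being non-zero is what later separates the two square
-- roots of `k`.
squarefree⇒≢0 : ∀ k → Squarefree k → k ≢ 0ℤ
squarefree⇒≢0 _ sf refl = contradiction (ℕ.∣1⇒≡1 (sf (+ 2) (4 ℕ.∣0))) λ ()

-- For a variable `k` the reduction inside `k ℚ./ 1` is stuck, so arithmetic with such fractions is
-- checked on unnormalised rationals.
toℚᵘ-/1 : ∀ k → toℚᵘ (k ℚ./ 1) ℚᵘ.≃ mkℚᵘ k 0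
toℚᵘ-/1 k = ℚ.toℚᵘ-fromℚᵘ (mkℚᵘ k 0)

/1-injective : ∀ {j k} → j ℚ./ 1 ≡ k ℚ./ 1 → j ≡ k
/1-injective {j} {k} eq with ℚ.fromℚᵘ-injective {mkℚᵘ j 0} {mkℚᵘ k 0} eq
... | *≡* eq′ = ≡.trans (≡.sym (ℤ.*-identityʳ j)) (≡.trans eq′ (ℤ.*-identityʳ k))

/1-homo-+ : ∀ j k → (j ℤ.+ k) ℚ./ 1 ≡ j ℚ./ 1 ℚ.+ k ℚ./ 1
/1-homo-+ j k = ℚ.toℚᵘ-injective (begin
  toℚᵘ ((j ℤ.+ k) ℚ./ 1)                ≈⟨ toℚᵘ-/1 (j ℤ.+ k) ⟩
  mkℚᵘ (j ℤ.+ k) 0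
    -- Unnormalised addition cross-multiplies, leaving the numerator `j * 1 + k * 1`.
    ≡⟨ ≡.cong (λ i → mkℚᵘ i 0) (≡.cong₂ ℤ._+_ (ℤ.*-identityʳ j) (ℤ.*-identityʳ k)) ⟨
  mkℚᵘ j 0 ℚᵘ.+ mkℚᵘ k 0                ≈⟨ ℚᵘ.+-cong (toℚᵘ-/1 j) (toℚᵘ-/1 k) ⟨
  toℚᵘ (j ℚ./ 1) ℚᵘ.+ toℚᵘ (k ℚ./ 1)    ≈⟨ ℚ.toℚᵘ-homo-+ (j ℚ./ 1) (k ℚ./ 1) ⟨
  toℚᵘ (j ℚ./ 1 ℚ.+ k ℚ./ 1)            ∎)
  where open SetoidReasoning ℚᵘ.≃-setoid

/1-homo-* : ∀ j k → (j ℤ.* k) ℚ./ 1 ≡ j ℚ./ 1 ℚ.* (k ℚ./ 1)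
/1-homo-* j k = ℚ.toℚᵘ-injective (begin
  toℚᵘ ((j ℤ.* k) ℚ./ 1)                ≈⟨ toℚᵘ-/1 (j ℤ.* k) ⟩
  mkℚᵘ j 0 ℚᵘ.* mkℚᵘ k 0                ≈⟨ ℚᵘ.*-cong (toℚᵘ-/1 j) (toℚᵘ-/1 k) ⟨
  toℚᵘ (j ℚ./ 1) ℚᵘ.* toℚᵘ (k ℚ./ 1)    ≈⟨ ℚ.toℚᵘ-homo-* (j ℚ./ 1) (k ℚ./ 1) ⟨
  toℚᵘ (j ℚ./ 1 ℚ.* (k ℚ./ 1))            ∎)
  where open SetoidReasoning ℚᵘ.≃-setoid

/1-homo-neg : ∀ k → (ℤ.- k) ℚ./ 1 ≡ ℚ.- (k ℚ./ 1)
/1-homo-neg k = ℚ.toℚᵘ-injective (begin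
  toℚᵘ ((ℤ.- k) ℚ./ 1)      ≈⟨ toℚᵘ-/1 (ℤ.- k) ⟩
  ℚᵘ.- (mkℚᵘ k 0)           ≈⟨ ℚᵘ.-‿cong (toℚᵘ-/1 k) ⟨
  ℚᵘ.- (toℚᵘ (k ℚ./ 1))     ≈⟨ ℚ.toℚᵘ-homo‿- (k ℚ./ 1) ⟨
  toℚᵘ (ℚ.- (k ℚ./ 1))      ∎)
  where open SetoidReasoning ℚᵘ.≃-setoid

½≢/1 : ∀ k → ½ ≢ k ℚ./ 1
½≢/1 k eq with ℚ.fromℚᵘ-injective {mkℚᵘ (+ 1) 1} {mkℚᵘ k 0} eq
-- The equation reads 1 · 1 = k · 2; computation refutes it once the shape of `k` is known.
½≢/1 +0       _ | *≡* ()
½≢/1 +[1+ _ ] _ | *≡* ()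
½≢/1 -[1+ _ ] _ | *≡* ()

-- Square roots in a field extension of ℚ.

module Extension (K : FieldOverℚ c ℓ₁ ℓ₂) where
  open FieldOverℚ K
    renaming (refl to ≈-refl; sym to ≈-sym; trans to ≈-trans)
  open RingMorphisms.IsRingHomomorphism ι-homo
    using ()
    renaming (⟦⟧-cong to ι-cong; +-homo to ι-+; *-homo to ι-*; -‿homo to ι-neg;
              0#-homo to ι-0; 1#-homo to ι-1)
  open HeytingCommutativeRingProperties heytingCommutativeRing
    using (1#0; x-0≈x; invertibleʳ⇒#)
  open RingProperties (CommutativeRing.ring commutativeRing)
    using (x∙y⁻¹≈ε⇒x≈y; x≈y⇒x∙y⁻¹≈ε; -1*x≈-x)
  open SetoidReasoning setoid

  private
    ι≟ : ∀ q r → Maybe (ι q ≈ ι r)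
    ι≟ q r with q ℚ.≟ r
    ... | yes q≡r = just (ι-cong q≡r)
    ... | no  _   = nothing

    -- Coefficients are taken in ℚ so that the solver can compute with 1/2.
    morphism : ℚ.+-*-rawRing -Raw-AlmostCommutative⟶ fromCommutativeRing commutativeRing
    morphism = record
      { ⟦_⟧ = ι ; +-homo = ι-+ ; *-homo = ι-* ; -‿homo = ι-neg ; 0-homo = ι-0 ; 1-homo = ι-1 }

  open RingSolver ℚ.+-*-rawRing (fromCommutativeRing commutativeRing) morphism ι≟
    using (solve; _:+_; _:*_; _:-_; :-_; con; _:=_)

  #-cancel : ∀ {x y} z → x # y → (x - y) * z ≈ 0# → z ≈ 0#
  #-cancel {x} {y} z x#y eq with #⇒invertible x#y
  -- Apartness supplies an inverse of `x - y`, by which the equation is divided.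
  ... | w , w[x-y]≈1 , _ = begin
    z                   ≈⟨ *-identityˡ z ⟨
    1# * z              ≈⟨ *-congʳ w[x-y]≈1 ⟨
    w * (x - y) * z     ≈⟨ *-assoc w (x - y) z ⟩
    w * ((x - y) * z)   ≈⟨ *-congˡ eq ⟩
    w * 0#              ≈⟨ zeroʳ w ⟩
    0#                  ∎

  1≉0 : ¬ 1# ≈ 0#
  1≉0 eq = #-irrefl eq 1#0

  ι-inverse : ∀ {q} → q ≢ 0ℚ → ∃[ r ] ι q * ι r ≈ 1#
  ι-inverse {q} q≢0 = 1/ q , (begin
    ι q * ι (1/ q)    ≈⟨ ι-* q (1/ q) ⟨
    ι (q ℚ.* 1/ q)    ≈⟨ ι-cong (ℚ.*-inverseʳ q) ⟩
    ι 1ℚ              ≈⟨ ι-1 ⟩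
    1#                ∎)
    where instance _ = ℚ.≢-nonZero q≢0

  -- Equality in ℚ is decidable, and a non-zero `q - r` would have an invertible image that is also
  -- 0.
  ι-injective : ∀ {q r} → ι q ≈ ι r → q ≡ r
  ι-injective {q} {r} eq with q ℚ.≟ r
  ... | yes q≡r = q≡r
  ... | no  q≢r = contradiction 1≈0 1≉0
    where
    inverse = ι-inverse {q ℚ.- r} λ q-r≡0 → q≢r (ℚ-x∙y⁻¹≈ε⇒x≈y q r q-r≡0)
      where open RingProperties ℚ.+-*-ring using () renaming (x∙y⁻¹≈ε⇒x≈y to ℚ-x∙y⁻¹≈ε⇒x≈y)
    s = proj₁ inverse
    1≈0 : 1# ≈ 0#
    1≈0 = begin
      1#                       ≈⟨ proj₂ inverse ⟨
      ι (q ℚ.- r) * ι s        ≈⟨ *-congʳ (≈-trans (ι-+ q (ℚ.- r)) (+-congˡ (ι-neg r))) ⟩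
      (ι q - ι r) * ι s        ≈⟨ *-congʳ (x≈y⇒x∙y⁻¹≈ε eq) ⟩
      0# * ι s                 ≈⟨ zeroˡ (ι s) ⟩
      0#                       ∎

  √#-√ : ∀ {a k} → k ≢ 0ℤ → a * a ≈ ιℤ k → a # - a
  √#-√ {a} {k} k≢0 a²≈k = invertibleʳ⇒# (a * (ι ½ * ι r) , (begin
    -- The difference of the roots is 2a, with inverse a / (2k) because a² = k; `r` is 1/k.
    (a - - a) * (a * (ι ½ * ι r))
      ≈⟨ solve 2 (λ x y → (x :- :- x) :* (x :* (con ½ :* y)) := x :* x :* y) ≈-refl a (ι r) ⟩
    a * a * ι r    ≈⟨ *-congʳ a²≈k ⟩
    ιℤ k * ι r     ≈⟨ kr≈1 ⟩
    1#             ∎))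
    where
    inverse = ι-inverse {k ℚ./ 1} λ eq → k≢0 (/1-injective eq)
    r       = proj₁ inverse
    kr≈1    = proj₂ inverse

  -- The product (y - x)(x + y) vanishes. Equality need not be decidable here, but cotransitivity
  -- makes `x` apart from `y` or from `- y`; the factor thereby invertible is cancelled.
  x²≈y²⇒x≈±y : ∀ {x y} → y # - y → x * x ≈ y * y → x ≈ y ⊎ x ≈ - y
  x²≈y²⇒x≈±y {x} {y} y#-y x²≈y² with #-cotrans y#-y x
  ... | inj₁ y#x = inj₂ (x∙y⁻¹≈ε⇒x≈y x (- y) (#-cancel (x - - y) y#x (begin
    (y - x) * (x - - y)
      ≈⟨ solve 2 (λ x y → (y :- x) :* (x :- :- y) := y :* y :- x :* x) ≈-refl x y ⟩
    y * y - x * x        ≈⟨ x≈y⇒x∙y⁻¹≈ε (≈-sym x²≈y²) ⟩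
    0#                   ∎)))
  ... | inj₂ x#-y = inj₁ (x∙y⁻¹≈ε⇒x≈y x y (#-cancel (x - y) x#-y (begin
    (x - - y) * (x - y)
      ≈⟨ solve 2 (λ x y → (x :- :- y) :* (x :- y) := x :* x :- y :* y) ≈-refl x y ⟩
    x * x - y * y        ≈⟨ x≈y⇒x∙y⁻¹≈ε x²≈y² ⟩
    0#                   ∎)))

  -- Subrings, adjunction of a square root, and the descent of 1/2.

  record IsSubring (B : Pred Carrier p) : Set (c ⊔ ℓ₁ ⊔ p) where
    field
      0-closed    : 0# ∈ B
      1-closed     : 1# ∈ B
      +-closed     : ∀ {x y} → x ∈ B → y ∈ B → x + y ∈ B
      -‿closed     : ∀ {x} → x ∈ B → - x ∈ B
      *-closed : ∀ {x y} → x ∈ B → y ∈ B → x * y ∈ B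
      ≈-closed    : ∀ {x y} → x ≈ y → x ∈ B → y ∈ B

    ιℕ-closed : ∀ n → ιℤ (+ n) ∈ B
    ιℕ-closed zero    = ≈-closed (≈-sym ι-0) 0-closed
    ιℕ-closed (suc n) = ≈-closed (begin
      1# + ιℤ (+ n)                 ≈⟨ +-congʳ ι-1 ⟨
      ι 1ℚ + ιℤ (+ n)               ≈⟨ ι-+ 1ℚ (+ n ℚ./ 1) ⟨
      ι (1ℚ ℚ.+ + n ℚ./ 1)          ≈⟨ ι-cong (/1-homo-+ (+ 1) (+ n)) ⟨
      ιℤ (+ suc n)                  ∎)
      (+-closed 1-closed (ιℕ-closed n))

    ιℤ-closed : ∀ k → ιℤ k ∈ B
    ιℤ-closed (+ n)    = ιℕ-closed n
    -- By definition, `-[1+ n ] ℚ./ 1` is the negative of `+[1+ n ] ℚ./ 1`.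
    ιℤ-closed -[1+ n ] = ≈-closed (≈-sym (ι-neg (+[1+ n ] ℚ./ 1))) (-‿closed (ιℕ-closed (suc n)))

  ⟨⟩-minimal : ∀ {q} {S : Pred Carrier p} {B : Pred Carrier q} → IsSubring B →
               (∀ {x} → x ∈ S → x ∈ B) → ∀ {x} → x ∈ ℤ⟨_⟩ commutativeRing S → x ∈ B
  ⟨⟩-minimal {S = S} {B} isSubring S⊆B = go
    where
    module B = IsSubring isSubring
    go : ∀ {x} → x ∈ ℤ⟨_⟩ commutativeRing S → x ∈ B
    go (generator s)   = S⊆B s
    go zero-∈          = B.0-closed
    go one-∈           = B.1-closed
    go (sum-∈ x y)     = B.+-closed (go x) (go y)
    go (neg-∈ x)       = B.-‿closed (go x)
    go (product-∈ x y) = B.*-closed (go x) (go y)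
    go (resp-∈ eq x)   = B.≈-closed eq (go x)

  Integers : Pred Carrier ℓ₁
  Integers x = ∃[ k ] ιℤ k ≈ x

  integers-isSubring : IsSubring Integers
  integers-isSubring = record
    { 0-closed    = + 0 , ι-0
    ; 1-closed     = + 1 , ι-1
    ; +-closed     = λ (j , j≈x) (k , k≈y) → j ℤ.+ k ,
        ≈-trans (≈-trans (ι-cong (/1-homo-+ j k)) (ι-+ _ _)) (+-cong j≈x k≈y)
    ; -‿closed     = λ (k , k≈x) → ℤ.- k ,
        ≈-trans (≈-trans (ι-cong (/1-homo-neg k)) (ι-neg _)) (-‿cong k≈x)
    ; *-closed = λ (j , j≈x) (k , k≈y) → j ℤ.* k ,
        ≈-trans (≈-trans (ι-cong (/1-homo-* j k)) (ι-* _ _)) (*-cong j≈x k≈y)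
    ; ≈-closed    = λ x≈y (k , k≈x) → k , ≈-trans k≈x x≈y
    }

  ½∉integers : ¬ ι ½ ∈ Integers
  ½∉integers (k , k≈½) = ½≢/1 k (ι-injective (≈-sym k≈½))

  module _ {B : Pred Carrier p} (isSubring : IsSubring B) {a} (a²∈B : a * a ∈ B) where
    open IsSubring isSubring

    Adjoin : Pred Carrier (c ⊔ ℓ₁ ⊔ p)
    Adjoin x = ∃[ u ] ∃[ v ] u ∈ B × v ∈ B × x ≈ u + v * a

    ⊆adjoin : ∀ {x} → x ∈ B → x ∈ Adjoin
    ⊆adjoin {x} x∈B = x , 0# , x∈B , 0-closed ,
      ≈-sym (≈-trans (+-congˡ (zeroˡ a)) (+-identityʳ x))

    ∈adjoin : a ∈ Adjoin
    ∈adjoin = 0# , 1# , 0-closed , 1-closed ,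
      ≈-sym (≈-trans (+-identityˡ (1# * a)) (*-identityˡ a))

    adjoin-isSubring : IsSubring Adjoin
    adjoin-isSubring = record
      { 0-closed    = ⊆adjoin 0-closed
      ; 1-closed     = ⊆adjoin 1-closed
      ; +-closed     = λ (u , v , u∈ , v∈ , x≈) (w , z , w∈ , z∈ , y≈) →
          u + w , v + z , +-closed u∈ w∈ , +-closed v∈ z∈ ,
          ≈-trans (+-cong x≈ y≈)
            (solve 5 (λ u v w z a → (u :+ v :* a) :+ (w :+ z :* a) := (u :+ w) :+ (v :+ z) :* a)
              ≈-refl u v w z a)
      ; -‿closed     = λ (u , v , u∈ , v∈ , x≈) → - u , - v , -‿closed u∈ , -‿closed v∈ ,
          ≈-trans (-‿cong x≈)
            (solve 3 (λ u v a → :- (u :+ v :* a) := :- u :+ :- v :* a) ≈-refl u v a)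
      ; *-closed = λ (u , v , u∈ , v∈ , x≈) (w , z , w∈ , z∈ , y≈) →
          u * w + v * z * (a * a) , u * z + v * w ,
          +-closed (*-closed u∈ w∈) (*-closed (*-closed v∈ z∈) a²∈B) ,
          +-closed (*-closed u∈ z∈) (*-closed v∈ w∈) ,
          ≈-trans (*-cong x≈ y≈)
            (solve 5 (λ u v w z a → (u :+ v :* a) :* (w :+ z :* a) :=
                (u :* w :+ v :* z :* (a :* a)) :+ (u :* z :+ v :* w) :* a)
              ≈-refl u v w z a)
      ; ≈-closed    = λ x≈y (u , v , u∈ , v∈ , x≈) →
          u , v , u∈ , v∈ , ≈-trans (≈-sym x≈y) x≈
      }

    ½∈adjoin⇒½∈ : ι ½ ∈ Adjoin → ι ½ ∈ B
    ½∈adjoin⇒½∈ (u , v , u∈ , v∈ , ½≈) =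
      ≈-closed eq (+-closed w∈ w∈)
      where
      -- Squaring v a = 1/2 - u gives v²a² = 1/4 - u + u², so `w` is 1/4 and its double is 1/2. Only
      -- the square of `a` enters `w`, which keeps it in `B`.
      w = (u - u * u) + v * v * (a * a)
      w∈ : w ∈ B
      w∈ = +-closed (+-closed u∈ (-‿closed (*-closed u∈ u∈))) (*-closed (*-closed v∈ v∈) a²∈B)
      va≈ : v * a ≈ ι ½ - u
      va≈ = begin
        v * a              ≈⟨ solve 3 (λ u v a → v :* a := (u :+ v :* a) :- u) ≈-refl u v a ⟩
        (u + v * a) - u    ≈⟨ +-congʳ ½≈ ⟨
        ι ½ - u            ∎
      eq : w + w ≈ ι ½
      eq = begin
        w + w
          ≈⟨ solve 3 (λ u v a →
               ((u :- u :* u) :+ v :* v :* (a :* a)) :+ ((u :- u :* u) :+ v :* v :* (a :* a)) :=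
               ((u :- u :* u) :+ (v :* a) :* (v :* a)) :+ ((u :- u :* u) :+ (v :* a) :* (v :* a)))
               ≈-refl u v a ⟩
        ((u - u * u) + (v * a) * (v * a)) + ((u - u * u) + (v * a) * (v * a))
          ≈⟨ +-cong (+-congˡ (*-cong va≈ va≈)) (+-congˡ (*-cong va≈ va≈)) ⟩
        ((u - u * u) + (ι ½ - u) * (ι ½ - u)) + ((u - u * u) + (ι ½ - u) * (ι ½ - u))
          ≈⟨ solve 1 (λ u →
               ((u :- u :* u) :+ (con ½ :- u) :* (con ½ :- u)) :+
               ((u :- u :* u) :+ (con ½ :- u) :* (con ½ :- u)) := con ½) ≈-refl u ⟩
        ι ½ ∎

  -- ℤ[a] + ℤ[a] b is a subring containing both generators, hence all of ℤ[a,b]. If it contained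
  -- 1/2, then so would ℤ[a], and then ℤ.
  ½∉ℤ[√,√] : ∀ {a b} j k → a * a ≈ ιℤ j → b * b ≈ ιℤ k → ¬ ι ½ ∈ ℤ⟨_⟩ commutativeRing (❴_,_❵ K a b)
  ½∉ℤ[√,√] {a} {b} j k a²≈j b²≈k ½∈ =
    ½∉integers (½∈adjoin⇒½∈ integers-isSubring a²∈
      (½∈adjoin⇒½∈ ℤ[a] b²∈ (⟨⟩-minimal ℤ[a][b] generators ½∈)))
    where
    a²∈       = IsSubring.≈-closed integers-isSubring (≈-sym a²≈j) (j , ≈-refl)
    ℤ[a]      = adjoin-isSubring integers-isSubring a²∈
    b²∈       = IsSubring.≈-closed ℤ[a] (≈-sym b²≈k) (IsSubring.ιℤ-closed ℤ[a] k)
    ℤ[a][b]   = adjoin-isSubring ℤ[a] b²∈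
    generators : ∀ {x} → x ∈ ❴_,_❵ K a b → x ∈ Adjoin ℤ[a] b²∈
    generators (inj₁ x≈a) = IsSubring.≈-closed ℤ[a][b] (≈-sym x≈a)
      (⊆adjoin ℤ[a] b²∈ (∈adjoin integers-isSubring a²∈))
    generators (inj₂ x≈b) = IsSubring.≈-closed ℤ[a][b] (≈-sym x≈b) (∈adjoin ℤ[a] b²∈)

  -- Non-zero endomorphisms of a generated subring.

  module Generated (S : Pred Carrier p) where
    A : Ring (c ⊔ ℓ₁ ⊔ p) ℓ₁
    A = CommutativeRing.ring (generatedSubring commutativeRing S)
    open Ring A using () renaming (Carrier to ∣A∣)

    ℤ⟨S⟩ : Pred Carrier (c ⊔ ℓ₁ ⊔ p)
    ℤ⟨S⟩ = ℤ⟨_⟩ commutativeRing S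

    module Endomorphism {σ : ∣A∣ → ∣A∣}
      (σ-homo : IsRingEndomorphism A σ) (σ≢0 : ¬ IsZeroMap A σ) where
      open RingWithoutOneMorphisms.IsRingWithoutOneHomomorphism σ-homo public
        using (⟦⟧-cong; +-homo; *-homo; 0#-homo) renaming (⁻¹-homo to neg-homo)

      -- Every x satisfies (σ 1 - 1) σ x = 0, so σ 1 apart from 1 would make σ the zero map.
      -- Tightness turns this into an equality.
      1-homo : proj₁ (σ (1# , one-∈)) ≈ 1#
      1-homo = proj₁ (tight e 1#) λ e#1 →
        σ≢0 λ x → #-cancel (proj₁ (σ x)) e#1 (begin
          (e - 1#) * proj₁ (σ x)
            ≈⟨ distribʳ (proj₁ (σ x)) e (- 1#) ⟩
          e * proj₁ (σ x) + - 1# * proj₁ (σ x)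
            ≈⟨ +-cong (*-homo (1# , one-∈) x) (≈-sym (-1*x≈-x (proj₁ (σ x)))) ⟨
          proj₁ (σ (1# * proj₁ x , _)) - proj₁ (σ x)
            ≈⟨ x≈y⇒x∙y⁻¹≈ε (⟦⟧-cong (*-identityˡ (proj₁ x))) ⟩
          0# ∎)
        where e = proj₁ (σ (1# , one-∈))

      -- σ acts on elements paired with a membership proof, so a fixed element carries one. As a
      -- subring, this predicate contains every integer.
      Fixed : Pred Carrier (c ⊔ ℓ₁ ⊔ p)
      Fixed x = Σ (x ∈ ℤ⟨S⟩) λ x∈ → proj₁ (σ (x , x∈)) ≈ x

      fixed-isSubring : IsSubring Fixed
      fixed-isSubring = record
        { 0-closed  = zero-∈ , 0#-homo
        ; 1-closed  = one-∈ , 1-homo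
        ; +-closed  = λ (x∈ , x≈) (y∈ , y≈) → sum-∈ x∈ y∈ , ≈-trans (+-homo _ _) (+-cong x≈ y≈)
        ; -‿closed  = λ (x∈ , x≈) → neg-∈ x∈ , ≈-trans (neg-homo _) (-‿cong x≈)
        ; *-closed  = λ (x∈ , x≈) (y∈ , y≈) → product-∈ x∈ y∈ , ≈-trans (*-homo _ _) (*-cong x≈ y≈)
        ; ≈-closed  = λ x≈y (x∈ , x≈) → resp-∈ x≈y x∈ ,
            ≈-trans (⟦⟧-cong (≈-sym x≈y)) (≈-trans x≈ x≈y)
        }

      -- σ fixes the integer `k`, so it sends a square root of `k` to a square root of `k`.
      σ√≈±√ : ∀ k → k ≢ 0ℤ → (x : ∣A∣) → proj₁ x * proj₁ x ≈ ιℤ k →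
              proj₁ (σ x) ≈ proj₁ x ⊎ proj₁ (σ x) ≈ - proj₁ x
      σ√≈±√ k k≢0 x x²≈k with IsSubring.ιℤ-closed fixed-isSubring k
      ... | k∈ , σk≈k = x²≈y²⇒x≈±y (√#-√ k≢0 x²≈k) (begin
        proj₁ (σ x) * proj₁ (σ x)                      ≈⟨ *-homo x x ⟨
        proj₁ (σ (proj₁ x * proj₁ x , _))              ≈⟨ ⟦⟧-cong x²≈k ⟩
        proj₁ (σ (ιℤ k , k∈))                          ≈⟨ σk≈k ⟩
        ιℤ k                                           ≈⟨ x²≈k ⟨
        proj₁ x * proj₁ x                              ∎)

    -- The outer derivation (τ - σ) / 2.

    module HalfDifference {σ τ : ∣A∣ → ∣A∣}
      (σ-homo : IsRingEndomorphism A σ) (τ-homo : IsRingEndomorphism A τ) where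
      private
        module σ = RingWithoutOneMorphisms.IsRingWithoutOneHomomorphism σ-homo
        module τ = RingWithoutOneMorphisms.IsRingWithoutOneHomomorphism τ-homo

      -- Valued in the field at first: that the halves lie in the subring is proved afterwards,
      -- using the algebraic identities below.
      γ[τ-σ] : ∣A∣ → Carrier
      γ[τ-σ] x = ι ½ * (proj₁ (τ x) - proj₁ (σ x))

      γ[τ-σ]-cong : ∀ {x y} → proj₁ x ≈ proj₁ y → γ[τ-σ] x ≈ γ[τ-σ] y
      γ[τ-σ]-cong eq = *-congˡ (+-cong (τ.⟦⟧-cong eq) (-‿cong (σ.⟦⟧-cong eq)))

      γ[τ-σ]-+ : ∀ x y → γ[τ-σ] (Ring._+_ A x y) ≈ γ[τ-σ] x + γ[τ-σ] y
      γ[τ-σ]-+ x y = ≈-trans (*-congˡ (+-cong (τ.+-homo x y) (-‿cong (σ.+-homo x y))))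
        (solve 4 (λ t t′ s s′ → con ½ :* ((t :+ t′) :- (s :+ s′)) :=
            con ½ :* (t :- s) :+ con ½ :* (t′ :- s′))
          ≈-refl (proj₁ (τ x)) (proj₁ (τ y)) (proj₁ (σ x)) (proj₁ (σ y)))

      γ[τ-σ]-neg : ∀ x → γ[τ-σ] (Ring.-_ A x) ≈ - γ[τ-σ] x
      γ[τ-σ]-neg x = ≈-trans (*-congˡ (+-cong (τ.⁻¹-homo x) (-‿cong (σ.⁻¹-homo x))))
        (solve 2 (λ t s → con ½ :* (:- t :- :- s) := :- (con ½ :* (t :- s)))
          ≈-refl (proj₁ (τ x)) (proj₁ (σ x)))

      -- Insert and remove σ x τ y in τ x τ y - σ x σ y; the factor 1/2 passes through by
      -- commutativity.
      γ[τ-σ]-leibniz : ∀ x y →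
        γ[τ-σ] (Ring._*_ A x y) ≈ γ[τ-σ] x * proj₁ (τ y) + proj₁ (σ x) * γ[τ-σ] y
      γ[τ-σ]-leibniz x y = ≈-trans (*-congˡ (+-cong (τ.*-homo x y) (-‿cong (σ.*-homo x y))))
        (solve 4 (λ t t′ s s′ → con ½ :* (t :* t′ :- s :* s′) :=
            (con ½ :* (t :- s)) :* t′ :+ s :* (con ½ :* (t′ :- s′)))
          ≈-refl (proj₁ (τ x)) (proj₁ (τ y)) (proj₁ (σ x)) (proj₁ (σ y)))

      γ[x-y]≈0 : ∀ {x y} → x ≈ y → ι ½ * (x - y) ≈ 0#
      γ[x-y]≈0 x≈y = ≈-trans (*-congˡ (x≈y⇒x∙y⁻¹≈ε x≈y)) (zeroʳ (ι ½))

      γ[τ-σ]-0 : γ[τ-σ] (Ring.0# A) ≈ 0#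
      γ[τ-σ]-0 = γ[x-y]≈0 (≈-trans τ.0#-homo (≈-sym σ.0#-homo))

      -- The difference τ x - σ x is 0, 2x or -2x according to the signs, so its half is 0, x or -x.
      γ[τ-σ]-± : (x : ∣A∣) →
        proj₁ (σ x) ≈ proj₁ x ⊎ proj₁ (σ x) ≈ - proj₁ x →
        proj₁ (τ x) ≈ proj₁ x ⊎ proj₁ (τ x) ≈ - proj₁ x →
        γ[τ-σ] x ∈ ℤ⟨S⟩
      γ[τ-σ]-± x (inj₁ σ+) (inj₁ τ+) = resp-∈ (≈-sym (γ[x-y]≈0 (≈-trans τ+ (≈-sym σ+)))) zero-∈
      γ[τ-σ]-± x (inj₂ σ-) (inj₂ τ-) = resp-∈ (≈-sym (γ[x-y]≈0 (≈-trans τ- (≈-sym σ-)))) zero-∈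
      γ[τ-σ]-± (x , x∈) (inj₂ σ-) (inj₁ τ+) = resp-∈
        (≈-trans (solve 1 (λ x → x := con ½ :* (x :- :- x)) ≈-refl x)
                 (≈-sym (*-congˡ (+-cong τ+ (-‿cong σ-)))))
        x∈
      γ[τ-σ]-± (x , x∈) (inj₁ σ+) (inj₂ τ-) = resp-∈
        (≈-trans (solve 1 (λ x → :- x := con ½ :* (:- x :- x)) ≈-refl x)
                 (≈-sym (*-congˡ (+-cong τ- (-‿cong σ+)))))
        (neg-∈ x∈)

      module _ (γ[τ-σ]-generator : ∀ {x} (x∈S : x ∈ S) → γ[τ-σ] (x , generator x∈S) ∈ ℤ⟨S⟩)
        (1∈ : γ[τ-σ] (1# , one-∈) ∈ ℤ⟨S⟩) where

        -- Induction on the generation of `x`. Products follow from the twisted Leibniz rule, since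
        -- σ and τ take values in the subring.
        γ[τ-σ]-∈ : ∀ {x} (x∈ : x ∈ ℤ⟨S⟩) → γ[τ-σ] (x , x∈) ∈ ℤ⟨S⟩
        γ[τ-σ]-∈ (generator x∈S)   = γ[τ-σ]-generator x∈S
        γ[τ-σ]-∈ zero-∈            = resp-∈ (≈-sym γ[τ-σ]-0) zero-∈
        γ[τ-σ]-∈ one-∈             = 1∈
        γ[τ-σ]-∈ (sum-∈ x∈ y∈)     =
          resp-∈ (≈-sym (γ[τ-σ]-+ _ _)) (sum-∈ (γ[τ-σ]-∈ x∈) (γ[τ-σ]-∈ y∈))
        γ[τ-σ]-∈ (neg-∈ x∈)        = resp-∈ (≈-sym (γ[τ-σ]-neg _)) (neg-∈ (γ[τ-σ]-∈ x∈))
        γ[τ-σ]-∈ (product-∈ x∈ y∈) = resp-∈ (≈-sym (γ[τ-σ]-leibniz _ _))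
          (sum-∈ (product-∈ (γ[τ-σ]-∈ x∈) (proj₂ (τ (_ , y∈))))
                 (product-∈ (proj₂ (σ (_ , x∈))) (γ[τ-σ]-∈ y∈)))
        γ[τ-σ]-∈ (resp-∈ eq x∈)    = resp-∈ (γ[τ-σ]-cong eq) (γ[τ-σ]-∈ x∈)

        open TwistedDerivations A σ τ using (Derivation)

        halfDifference : Derivation
        halfDifference = record
          { D        = λ x → γ[τ-σ] x , γ[τ-σ]-∈ (proj₂ x)
          ; ℤ-linear = record
            { isMonoidHomomorphism = record
              { isMagmaHomomorphism = record
                { isRelHomomorphism = record { cong = γ[τ-σ]-cong }
                ; homo = γ[τ-σ]-+ }
              ; ε-homo = γ[τ-σ]-0 }
            ; ⁻¹-homo = γ[τ-σ]-neg }
          ; leibniz  = γ[τ-σ]-leibniz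
          }

        -- If β implements the derivation, then (β - 1/2)(τ x - σ x) = 0 for all x. So β apart from
        -- 1/2 would force σ = τ, and tightness puts 1/2 = β in the subring.
        halfDifference-outer : ¬ _≗_ A σ τ → ¬ ι ½ ∈ ℤ⟨S⟩ → Nontrivial (Out A σ τ)
        halfDifference-outer σ≢τ ½∉ = halfDifference , λ ((β , β∈) , D≈) →
          ½∉ (resp-∈ (proj₁ (tight β (ι ½)) λ β#½ → σ≢τ λ x →
            ≈-sym (x∙y⁻¹≈ε⇒x≈y _ _ (#-cancel (proj₁ (τ x) - proj₁ (σ x)) β#½ (begin
              (β - ι ½) * (proj₁ (τ x) - proj₁ (σ x))
                ≈⟨ solve 3 (λ b t s → (b :- con ½) :* (t :- s) :=
                     (b :* t :- s :* b) :- con ½ :* (t :- s)) ≈-refl β (proj₁ (τ x)) (proj₁ (σ x)) ⟩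
              (β * proj₁ (τ x) - proj₁ (σ x) * β) - γ[τ-σ] x
                -- Being zero in the quotient means that the difference with the zero derivation is
                -- inner, hence the subtracted 0 to be removed.
                ≈⟨ x≈y⇒x∙y⁻¹≈ε (≈-trans (≈-sym (D≈ x)) (x-0≈x (γ[τ-σ] x))) ⟩
              0# ∎)))) β∈)

corollary3p24 : ∀ {c ℓ₁ ℓ₂} (K : FieldOverℚ c ℓ₁ ℓ₂) (let open FieldOverℚ K)
    (m n : ℤ) → m ≢ n → Squarefree m → Squarefree n →
    (√m √n : Carrier) → √m * √m ≈ ιℤ m → √n * √n ≈ ιℤ n →
    IsGeneratedBy K √m √n → HasDegree K 4 →
    let A = ℤ[_,_] K √m √n in
    (σ τ : Ring.Carrier A → Ring.Carrier A) →
    IsRingEndomorphism A σ → IsRingEndomorphism A τ →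
    ¬ IsZeroMap A σ → ¬ IsZeroMap A τ → ¬ (_≗_ A σ τ) →
    Nontrivial (Out A σ τ)
corollary3p24 K m n _ m-squarefree n-squarefree √m √n √m²≈m √n²≈n _ _
  σ τ σ-homo τ-homo σ≢0 τ≢0 σ≢τ =
  halfDifference-outer generators 1∈ σ≢τ (½∉ℤ[√,√] m n √m²≈m √n²≈n)
  where
  open FieldOverℚ K using (_≈_; _*_; ιℤ; *-cong; trans)
  open Extension K
  open Generated (❴_,_❵ K √m √n)
  open HalfDifference σ-homo τ-homo
  module σ = Endomorphism σ-homo σ≢0
  module τ = Endomorphism τ-homo τ≢0

  -- Stated for any square root `x` of `k`, because a generator is only known to be `≈` to `√m` or
  -- `√n`.
  √-∈ : ∀ k → Squarefree k → (x : Ring.Carrier A) → proj₁ x * proj₁ x ≈ ιℤ k → γ[τ-σ] x ∈ ℤ⟨S⟩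
  √-∈ k sf x x²≈k = γ[τ-σ]-± x (σ.σ√≈±√ k k≢0 x x²≈k) (τ.σ√≈±√ k k≢0 x x²≈k)
    where k≢0 = squarefree⇒≢0 k sf

  generators : ∀ {x} (x∈S : ❴_,_❵ K √m √n x) → γ[τ-σ] (x , generator x∈S) ∈ ℤ⟨S⟩
  generators (inj₁ x≈√m) = √-∈ m m-squarefree _ (trans (*-cong x≈√m x≈√m) √m²≈m)
  generators (inj₂ x≈√n) = √-∈ n n-squarefree _ (trans (*-cong x≈√n x≈√n) √n²≈n)

  1∈ : γ[τ-σ] (_ , one-∈) ∈ ℤ⟨S⟩
  -- Both endomorphisms fix 1, so the half-difference there is 0.
  1∈ = γ[τ-σ]-± _ (inj₁ σ.1-homo) (inj₁ τ.1-homo)
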